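{- Let $\mathbb{K}$ be a field and $f=a_0(x)+a_1(x)y+\cdots+a_n(x)y^n\in\mathbb{K}[x,y]$ with $n\geq 2$, $a_0,\ldots,a_{n-1}\in\mathbb{K}[x]$, $a_n\in\mathbb{K}$, $a_0a_n\neq 0$, and suppose there exists an index $j$ with $0\leq j\leq n-1$ such that $\deg a_j>\max_{i\neq j}\deg a_i$. Then $f$ is a product of at most $n-j$ irreducible polynomials over $\mathbb{K}[x]$. In particular, if $j=n-1$, then $f$ is irreducible over $\mathbb{K}[x]$.
   Context: $f$ is regarded as a polynomial in $y$ with coefficients in $\mathbb{K}[x]$; "a product of at most $k$ irreducible polynomials over $\mathbb{K}[x]$" means that in the factorization of $f$ into irreducible elements of $\mathbb{K}[x][y]$ the number of factors, counted with multiplicities, is at most $k$. -}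

module Defs where

open import Algebra.Bundles using (CommutativeRing)
open import Algebra.Bundles.Raw using (RawRing; RawSemiring)
import Algebra.Definitions
import Algebra.Definitions.RawSemiring as RawSemiringDefinitions
open import Axiom.ExcludedMiddle using (ExcludedMiddle)
open import Data.List.Base using (List; []; _∷_; foldr; length; map)
open import Data.List.Relation.Unary.All using (All)
open import Data.Nat.Base using (ℕ; zero; suc; _≤_)
import Data.Nat.Base as ℕ
open import Data.Product.Base using (_×_; ∃-syntax)
open import Level using (Level; Lift; lift; lower; _⊔_) renaming (suc to lsuc)
open import Relation.Binary.Construct.Add.Infimum.Strict ℕ._<_ public
  using (_<₋_)
open import Relation.Nullary.Construct.Add.Infimum using (_₋; ⊥₋; [_])
open import Relation.Nullary.Decidable.Core using (Dec; yes; no; map′)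
open import Relation.Unary using (Decidable)

private
  variable
    c ℓ : Level

record Field c ℓ : Set (lsuc (c ⊔ ℓ)) where
  field
    commutativeRing : CommutativeRing c ℓ
  open CommutativeRing commutativeRing public
  open Algebra.Definitions _≈_ using (Invertible)
  field
    1≉0           : 1# ≉ 0#
    ≉0⇒invertible : ∀ {x} → x ≉ 0# → Invertible 1# _*_ x

-- Polynomials are lists of coefficients, constant term first.  Trailing zeros
-- are allowed, so equality is equality of all coefficients.
module Polynomial (R : RawRing c ℓ) where
  open RawRing R

  infix 4 _≈ₚ_
  infixl 6 _+ₚ_
  infixl 7 _*ₚ_

  coeff : List Carrier → ℕ → Carrier
  coeff []      _       = 0#
  coeff (a ∷ p) zero    = a
  coeff (a ∷ p) (suc i) = coeff p i

  _≈ₚ_ : List Carrier → List Carrier → Set ℓ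
  p ≈ₚ q = ∀ i → coeff p i ≈ coeff q i

  _+ₚ_ : List Carrier → List Carrier → List Carrier
  []      +ₚ q       = q
  (a ∷ p) +ₚ []      = a ∷ p
  (a ∷ p) +ₚ (b ∷ q) = a + b ∷ p +ₚ q

  _*ₚ_ : List Carrier → List Carrier → List Carrier
  []      *ₚ q = []
  (a ∷ p) *ₚ q = map (a *_) q +ₚ (0# ∷ p *ₚ q)

  constant : Carrier → List Carrier
  constant a = a ∷ []

  -- The zero polynomial, in any of its representations, has degree ⊥₋ (= -∞).
  deg : Decidable (_≈ 0#) → List Carrier → ℕ ₋
  deg _≟0 []      = ⊥₋
  deg _≟0 (a ∷ p) with deg _≟0 p | a ≟0
  ... | [ d ] | _     = [ suc d ]
  ... | ⊥₋    | yes _ = ⊥₋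
  ... | ⊥₋    | no  _ = [ 0 ]

infixl 10 _[X]

_[X] : RawRing c ℓ → RawRing c ℓ
R [X] = record
  { Carrier = List Carrier
  ; _≈_     = _≈ₚ_
  ; _+_     = _+ₚ_
  ; _*_     = _*ₚ_
  ; -_      = map -_
  ; 0#      = []
  ; 1#      = constant 1#
  }
  where
  open RawRing R
  open Polynomial R

≈0? : ExcludedMiddle (c ⊔ ℓ) → (R : RawRing c ℓ) →
      let open RawRing R in Decidable (_≈ 0#)
≈0? {c} em R x = map′ lower lift (em {Lift c (x ≈ 0#)})
  where open RawRing R

module _ (S : RawSemiring c ℓ) where
  open RawSemiring S
  open RawSemiringDefinitions S using (Irreducible)

  -- The factors are listed with multiplicity.  No unit factor is
  -- needed as long as f is not a unit: it can be absorbed into an irreducible.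
  IrreducibleFactorization : Carrier → List Carrier → Set (c ⊔ ℓ)
  IrreducibleFactorization f ps = All Irreducible ps × f ≈ foldr _*_ 1# ps

  ProductOfAtMost : ℕ → Carrier → Set (c ⊔ ℓ)
  ProductOfAtMost k f =
    (∃[ ps ] IrreducibleFactorization f ps) ×
    (∀ ps → IrreducibleFactorization f ps → length ps ≤ k)

{-# OPTIONS --safe #-}
module Submission where

-- Compare monomials y^i x^k in two ways: by y first, and by x first with ties
-- broken in favour of low powers of y.  Leading exponents are additive for both
-- orders.  If they are (m , e) and (s , D) respectively, then s ≤ m and the weight
-- m − s is additive too.  A divisor g of f has e = 0 (as a_n ∈ K) and y ∤ g (as
-- a_0 ≠ 0); if moreover its weight is 0, its leading coefficient in y has the
-- strictly largest x-degree, which is 0, so g is a monomial in y, hence a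
-- constant.  Thus every nonunit divisor of f has positive weight, and the weight
-- of f is n − j.

open import Algebra.Bundles using (Monoid; Ring; Semiring)
open import Algebra.Bundles.Raw using (RawRing)
import Algebra.Definitions.RawSemiring as RawSemiringDefinitions
open import Algebra.Definitions.RawSemiring using (Irreducible; mkIrred)
open import Algebra.Definitions.RawMagma using (_,_)
open import Algebra.Morphism.Construct.Identity using (isMonoidHomomorphism)
open import Algebra.Morphism.Structures using (module MonoidMorphisms)
import Algebra.Properties.CommutativeSemigroup as CommutativeSemigroupProperties
import Algebra.Properties.Ring as RingProperties
open import Axiom.ExcludedMiddle using (ExcludedMiddle)
open import Data.Fin.Base using (Fin; zero; suc; fromℕ; fromℕ<; inject₁; toℕ)
import Data.Fin.Properties as Fin
open import Data.List.Base
  using (List; []; _∷_; _++_; map; length; foldr; upTo; cartesianProduct; tabulate)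
open import Data.List.Membership.Propositional using (_∈_)
open import Data.List.Membership.Propositional.Properties using (∈-upTo⁺; ∈-cartesianProduct⁺)
open import Data.List.Properties using (length-tabulate)
open import Data.List.Relation.Unary.All as All using (All; []; _∷_)
open import Data.List.Relation.Unary.All.Properties using (++⁺)
open import Data.Nat.Base as ℕ using (ℕ; zero; suc; _≤_; _<_; _>_; _∸_; z≤n; s≤s; z<s)
open import Data.Nat.Induction using (<-wellFounded)
import Data.Nat.Properties as ℕ
open import Data.Product.Base using (_×_; _,_; proj₁; proj₂; ∃-syntax; swap)
open import Data.Product.Relation.Binary.Lex.Strict using (×-Lex; ×-compare; ×-transitive)
open import Data.Product.Relation.Binary.Pointwise.NonDependent using (≡×≡⇒≡; ≡⇒≡×≡)
open import Data.Sum.Base using (_⊎_; inj₁; inj₂)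
open import Function.Base using (_∘_; _on_; const; flip)
open import Induction.WellFounded using (Acc; acc)
open import Level using (_⊔_; 0ℓ)
open import Relation.Binary.Consequences using (tri⇒irr)
open import Relation.Binary.Construct.Add.Infimum.Strict _<_ using (⊥₋<[_]; [_])
import Relation.Binary.Construct.Flip.EqAndOrd as Flip
open import Relation.Binary.Core using (Rel)
open import Relation.Binary.Definitions using (Trichotomous; Transitive; tri<; tri≈; tri>)
open import Relation.Binary.PropositionalEquality.Core as ≡ using (_≡_; _≢_)
import Relation.Binary.PropositionalEquality.Properties as ≡
import Relation.Binary.Reasoning.Setoid as SetoidReasoning
open import Relation.Nullary.Construct.Add.Infimum using (_₋; ⊥₋; [_])
open import Relation.Nullary.Decidable.Core using (yes; no; ¬?; decidable-stable)
open import Relation.Nullary.Negation.Core using (¬_; contradiction)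
open import Relation.Unary using (Pred; Decidable; ∁)
open import Defs

-- The ring of polynomials over a ring.

module Polynomials {c ℓ} (R : Ring c ℓ) where
  open Ring R hiding (zero; _-_)
  open Polynomial rawRing public
  open CommutativeSemigroupProperties +-commutativeSemigroup using (interchange)
  open RingProperties R using (-0#≈0#)
  open SetoidReasoning setoid

  coeff-+ : ∀ p q i → coeff (p +ₚ q) i ≈ coeff p i + coeff q i
  coeff-+ []      q       i       = sym (+-identityˡ _)
  coeff-+ (a ∷ p) []      i       = sym (+-identityʳ _)
  coeff-+ (a ∷ p) (b ∷ q) zero    = refl
  coeff-+ (a ∷ p) (b ∷ q) (suc i) = coeff-+ p q i

  coeff-map : ∀ {f} → f 0# ≈ 0# → ∀ p i → coeff (map f p) i ≈ f (coeff p i)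
  coeff-map f0≈0 []      i       = sym f0≈0
  coeff-map f0≈0 (a ∷ p) zero    = refl
  coeff-map f0≈0 (a ∷ p) (suc i) = coeff-map f0≈0 p i

  -- Coefficient form of (a + Xp)q = aq + X(pq), on which the product lemmas below rest.
  coeff-∷-* : ∀ a p q i →
              coeff ((a ∷ p) *ₚ q) i ≈ a * coeff q i + coeff (0# ∷ p *ₚ q) i
  coeff-∷-* a p q i = trans (coeff-+ (map (a *_) q) _ i)
    (+-congʳ (coeff-map (zeroʳ a) q i))

  coeff-≥length : ∀ p {i} → length p ≤ i → coeff p i ≡ 0#
  coeff-≥length []      _           = ≡.refl
  coeff-≥length (a ∷ p) (s≤s len≤i) = coeff-≥length p len≤i

  coeff-tabulate : ∀ {n} (a : Fin n → Carrier) i → coeff (tabulate a) (toℕ i) ≡ a i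
  coeff-tabulate a zero    = ≡.refl
  coeff-tabulate a (suc i) = coeff-tabulate (a ∘ suc) i

  ∷-cong : ∀ {a b} p q → a ≈ b → p ≈ₚ q → a ∷ p ≈ₚ b ∷ q
  ∷-cong p q a≈b p≈q zero    = a≈b
  ∷-cong p q a≈b p≈q (suc i) = p≈q i

  0∷[] : 0# ∷ [] ≈ₚ []
  0∷[] zero    = refl
  0∷[] (suc i) = refl

  +ₚ-cong : ∀ p q r s → p ≈ₚ q → r ≈ₚ s → p +ₚ r ≈ₚ q +ₚ s
  +ₚ-cong p q r s p≈q r≈s i = begin
    coeff (p +ₚ r) i        ≈⟨ coeff-+ p r i ⟩
    coeff p i + coeff r i   ≈⟨ +-cong (p≈q i) (r≈s i) ⟩
    coeff q i + coeff s i   ≈⟨ coeff-+ q s i ⟨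
    coeff (q +ₚ s) i        ∎

  +ₚ-assoc : ∀ p q r → (p +ₚ q) +ₚ r ≈ₚ p +ₚ (q +ₚ r)
  +ₚ-assoc p q r i = begin
    coeff (p +ₚ q +ₚ r) i                 ≈⟨ coeff-+ (p +ₚ q) r i ⟩
    coeff (p +ₚ q) i + coeff r i          ≈⟨ +-congʳ (coeff-+ p q i) ⟩
    coeff p i + coeff q i + coeff r i     ≈⟨ +-assoc _ _ _ ⟩
    coeff p i + (coeff q i + coeff r i)   ≈⟨ +-congˡ (coeff-+ q r i) ⟨
    coeff p i + coeff (q +ₚ r) i          ≈⟨ coeff-+ p (q +ₚ r) i ⟨
    coeff (p +ₚ (q +ₚ r)) i               ∎

  +ₚ-comm : ∀ p q → p +ₚ q ≈ₚ q +ₚ p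
  +ₚ-comm p q i = begin
    coeff (p +ₚ q) i        ≈⟨ coeff-+ p q i ⟩
    coeff p i + coeff q i   ≈⟨ +-comm _ _ ⟩
    coeff q i + coeff p i   ≈⟨ coeff-+ q p i ⟨
    coeff (q +ₚ p) i        ∎

  +ₚ-identityʳ : ∀ p → p +ₚ [] ≈ₚ p
  +ₚ-identityʳ p i = trans (coeff-+ p [] i) (+-identityʳ _)

  -ₚ-inverseˡ : ∀ p → map -_ p +ₚ p ≈ₚ []
  -ₚ-inverseˡ p i = begin
    coeff (map -_ p +ₚ p) i          ≈⟨ coeff-+ (map -_ p) p i ⟩
    coeff (map -_ p) i + coeff p i   ≈⟨ +-congʳ (coeff-map -0#≈0# p i) ⟩
    - coeff p i + coeff p i          ≈⟨ -‿inverseˡ _ ⟩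
    0#                               ∎

  -ₚ-cong : ∀ p q → p ≈ₚ q → map -_ p ≈ₚ map -_ q
  -ₚ-cong p q p≈q i = begin
    coeff (map -_ p) i   ≈⟨ coeff-map -0#≈0# p i ⟩
    - coeff p i          ≈⟨ -‿cong (p≈q i) ⟩
    - coeff q i          ≈⟨ coeff-map -0#≈0# q i ⟨
    coeff (map -_ q) i   ∎

  ∷-*-cong : ∀ {a b} p q r s → a ≈ b → r ≈ₚ s → p *ₚ r ≈ₚ q *ₚ s →
             (a ∷ p) *ₚ r ≈ₚ (b ∷ q) *ₚ s
  ∷-*-cong {a} {b} p q r s a≈b r≈s pr≈qs i = begin
    coeff ((a ∷ p) *ₚ r) i                     ≈⟨ coeff-∷-* a p r i ⟩
    a * coeff r i + coeff (0# ∷ p *ₚ r) i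
      ≈⟨ +-cong (*-cong a≈b (r≈s i)) (∷-cong (p *ₚ r) (q *ₚ s) refl pr≈qs i) ⟩
    b * coeff s i + coeff (0# ∷ q *ₚ s) i      ≈⟨ coeff-∷-* b q s i ⟨
    coeff ((b ∷ q) *ₚ s) i                     ∎

  -- A zero polynomial may be a nonempty list of zeros, hence the induction. `*ₚ-cong` falls back on
  -- this when one list runs out before the other.
  *ₚ-zeroˡ : ∀ p q → p ≈ₚ [] → p *ₚ q ≈ₚ []
  *ₚ-zeroˡ []      q p≈0 i = refl
  *ₚ-zeroˡ (a ∷ p) q p≈0 i = begin
    coeff ((a ∷ p) *ₚ q) i                  ≈⟨ coeff-∷-* a p q i ⟩
    a * coeff q i + coeff (0# ∷ p *ₚ q) i
      ≈⟨ +-cong (*-congʳ (p≈0 0)) (∷-cong (p *ₚ q) [] refl (*ₚ-zeroˡ p q (p≈0 ∘ suc)) i) ⟩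
    0# * coeff q i + coeff (0# ∷ []) i      ≈⟨ +-cong (zeroˡ _) (0∷[] i) ⟩
    0# + 0#                                 ≈⟨ +-identityˡ 0# ⟩
    0#                                      ∎

  *ₚ-cong : ∀ p q r s → p ≈ₚ q → r ≈ₚ s → p *ₚ r ≈ₚ q *ₚ s
  *ₚ-cong []      q       r s p≈q r≈s i = sym (*ₚ-zeroˡ q s (sym ∘ p≈q) i)
  *ₚ-cong (a ∷ p) []      r s p≈q r≈s   = *ₚ-zeroˡ (a ∷ p) r p≈q
  *ₚ-cong (a ∷ p) (b ∷ q) r s p≈q r≈s   =
    ∷-*-cong p q r s (p≈q 0) r≈s (*ₚ-cong p q r s (p≈q ∘ suc) r≈s)

  *ₚ-distribʳ : ∀ r p q → (p +ₚ q) *ₚ r ≈ₚ p *ₚ r +ₚ q *ₚ r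
  *ₚ-distribʳ r []      q       i = refl
  *ₚ-distribʳ r (a ∷ p) []      i = sym (+ₚ-identityʳ ((a ∷ p) *ₚ r) i)
  *ₚ-distribʳ r (a ∷ p) (b ∷ q) i = begin
    coeff ((a + b ∷ p +ₚ q) *ₚ r) i
      ≈⟨ coeff-∷-* (a + b) (p +ₚ q) r i ⟩
    (a + b) * coeff r i + coeff (0# ∷ (p +ₚ q) *ₚ r) i
      ≈⟨ +-cong (distribʳ _ a b)
                 (∷-cong _ (p *ₚ r +ₚ q *ₚ r) (sym (+-identityˡ 0#)) (*ₚ-distribʳ r p q) i) ⟩
    a * coeff r i + b * coeff r i + coeff ((0# ∷ p *ₚ r) +ₚ (0# ∷ q *ₚ r)) i
      ≈⟨ +-congˡ (coeff-+ (0# ∷ p *ₚ r) (0# ∷ q *ₚ r) i) ⟩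
    a * coeff r i + b * coeff r i + (coeff (0# ∷ p *ₚ r) i + coeff (0# ∷ q *ₚ r) i)
      ≈⟨ interchange _ _ _ _ ⟩
    a * coeff r i + coeff (0# ∷ p *ₚ r) i + (b * coeff r i + coeff (0# ∷ q *ₚ r) i)
      ≈⟨ +-cong (coeff-∷-* a p r i) (coeff-∷-* b q r i) ⟨
    coeff ((a ∷ p) *ₚ r) i + coeff ((b ∷ q) *ₚ r) i
      ≈⟨ coeff-+ ((a ∷ p) *ₚ r) _ i ⟨
    coeff ((a ∷ p) *ₚ r +ₚ (b ∷ q) *ₚ r) i ∎

  *ₚ-distribˡ : ∀ p q r → p *ₚ (q +ₚ r) ≈ₚ p *ₚ q +ₚ p *ₚ r
  *ₚ-distribˡ []      q r i = refl
  *ₚ-distribˡ (a ∷ p) q r i = begin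
    coeff ((a ∷ p) *ₚ (q +ₚ r)) i
      ≈⟨ coeff-∷-* a p (q +ₚ r) i ⟩
    a * coeff (q +ₚ r) i + coeff (0# ∷ p *ₚ (q +ₚ r)) i
      ≈⟨ +-cong (*-congˡ (coeff-+ q r i))
                 (∷-cong _ (p *ₚ q +ₚ p *ₚ r) (sym (+-identityˡ 0#)) (*ₚ-distribˡ p q r) i) ⟩
    a * (coeff q i + coeff r i) + coeff ((0# ∷ p *ₚ q) +ₚ (0# ∷ p *ₚ r)) i
      ≈⟨ +-cong (distribˡ a _ _) (coeff-+ (0# ∷ p *ₚ q) (0# ∷ p *ₚ r) i) ⟩
    a * coeff q i + a * coeff r i + (coeff (0# ∷ p *ₚ q) i + coeff (0# ∷ p *ₚ r) i)
      ≈⟨ interchange _ _ _ _ ⟩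
    a * coeff q i + coeff (0# ∷ p *ₚ q) i + (a * coeff r i + coeff (0# ∷ p *ₚ r) i)
      ≈⟨ +-cong (coeff-∷-* a p q i) (coeff-∷-* a p r i) ⟨
    coeff ((a ∷ p) *ₚ q) i + coeff ((a ∷ p) *ₚ r) i
      ≈⟨ coeff-+ ((a ∷ p) *ₚ q) _ i ⟨
    coeff ((a ∷ p) *ₚ q +ₚ (a ∷ p) *ₚ r) i ∎

  0∷-* : ∀ p q → (0# ∷ p) *ₚ q ≈ₚ 0# ∷ p *ₚ q
  0∷-* p q i = begin
    coeff ((0# ∷ p) *ₚ q) i                  ≈⟨ coeff-∷-* 0# p q i ⟩
    0# * coeff q i + coeff (0# ∷ p *ₚ q) i   ≈⟨ +-congʳ (zeroˡ _) ⟩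
    0# + coeff (0# ∷ p *ₚ q) i               ≈⟨ +-identityˡ _ ⟩
    coeff (0# ∷ p *ₚ q) i                    ∎

  scale-* : ∀ a p q → map (a *_) p *ₚ q ≈ₚ map (a *_) (p *ₚ q)
  scale-* a []      q i = refl
  scale-* a (b ∷ p) q i = begin
    coeff ((a * b ∷ map (a *_) p) *ₚ q) i
      ≈⟨ coeff-∷-* (a * b) (map (a *_) p) q i ⟩
    a * b * coeff q i + coeff (0# ∷ map (a *_) p *ₚ q) i
      -- The 0 heading the shifted product is read as a · 0, so that `map (a *_)` covers the whole
      -- list.
      ≈⟨ +-cong (*-assoc a b _)
                 (∷-cong _ (map (a *_) (p *ₚ q)) (sym (zeroʳ a)) (scale-* a p q) i) ⟩
    a * (b * coeff q i) + coeff (map (a *_) (0# ∷ p *ₚ q)) i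
      ≈⟨ +-congˡ (coeff-map (zeroʳ a) (0# ∷ p *ₚ q) i) ⟩
    a * (b * coeff q i) + a * coeff (0# ∷ p *ₚ q) i
      ≈⟨ distribˡ a _ _ ⟨
    a * (b * coeff q i + coeff (0# ∷ p *ₚ q) i)
      ≈⟨ *-congˡ (coeff-∷-* b p q i) ⟨
    a * coeff ((b ∷ p) *ₚ q) i
      ≈⟨ coeff-map (zeroʳ a) ((b ∷ p) *ₚ q) i ⟨
    coeff (map (a *_) ((b ∷ p) *ₚ q)) i ∎

  *ₚ-assoc : ∀ p q r → (p *ₚ q) *ₚ r ≈ₚ p *ₚ (q *ₚ r)
  *ₚ-assoc []      q r i = refl
  *ₚ-assoc (a ∷ p) q r i = begin
    coeff ((map (a *_) q +ₚ (0# ∷ p *ₚ q)) *ₚ r) i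
      ≈⟨ *ₚ-distribʳ r (map (a *_) q) (0# ∷ p *ₚ q) i ⟩
    coeff (map (a *_) q *ₚ r +ₚ (0# ∷ p *ₚ q) *ₚ r) i
      ≈⟨ coeff-+ (map (a *_) q *ₚ r) ((0# ∷ p *ₚ q) *ₚ r) i ⟩
    coeff (map (a *_) q *ₚ r) i + coeff ((0# ∷ p *ₚ q) *ₚ r) i
      ≈⟨ +-cong (scale-* a q r i) (0∷-* (p *ₚ q) r i) ⟩
    coeff (map (a *_) (q *ₚ r)) i + coeff (0# ∷ (p *ₚ q) *ₚ r) i
      ≈⟨ +-congˡ (∷-cong _ (p *ₚ (q *ₚ r)) refl (*ₚ-assoc p q r) i) ⟩
    coeff (map (a *_) (q *ₚ r)) i + coeff (0# ∷ p *ₚ (q *ₚ r)) i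
      ≈⟨ coeff-+ (map (a *_) (q *ₚ r)) (0# ∷ p *ₚ (q *ₚ r)) i ⟨
    coeff ((a ∷ p) *ₚ (q *ₚ r)) i ∎

  *ₚ-identityˡ : ∀ p → constant 1# *ₚ p ≈ₚ p
  *ₚ-identityˡ p i = begin
    coeff (constant 1# *ₚ p) i           ≈⟨ coeff-∷-* 1# [] p i ⟩
    1# * coeff p i + coeff (0# ∷ []) i   ≈⟨ +-cong (*-identityˡ _) (0∷[] i) ⟩
    coeff p i + 0#                       ≈⟨ +-identityʳ _ ⟩
    coeff p i                            ∎

  *ₚ-identityʳ : ∀ p → p *ₚ constant 1# ≈ₚ p
  *ₚ-identityʳ []      i       = refl
  *ₚ-identityʳ (a ∷ p) zero    = trans (+-identityʳ _) (*-identityʳ a)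
  *ₚ-identityʳ (a ∷ p) (suc i) = *ₚ-identityʳ p i

  -- The operations agree definitionally with those of `_[X]`, so facts about this ring are facts
  -- about the polynomials of the statement. Any ring may serve as base, so two applications give
  -- K[x][y].
  polynomialRing : Ring c ℓ
  polynomialRing = record
    { Carrier = List Carrier
    ; _≈_     = _≈ₚ_
    ; _+_     = _+ₚ_
    ; _*_     = _*ₚ_
    ; -_      = map -_
    ; 0#      = []
    ; 1#      = constant 1#
    ; isRing  = record
      { +-isAbelianGroup = record
        { isGroup = record
          { isMonoid = record
            { isSemigroup = record
              { isMagma = record
                { isEquivalence = record
                  { refl  = λ i → refl
                  ; sym   = λ p≈q i → sym (p≈q i)
                  ; trans = λ p≈q q≈r i → trans (p≈q i) (q≈r i)
                  }
                ; ∙-cong = λ {p} {q} {r} {s} → +ₚ-cong p q r s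
                }
              ; assoc = +ₚ-assoc
              }
            ; identity = (λ p i → refl) , +ₚ-identityʳ
            }
          ; inverse = -ₚ-inverseˡ , λ p i → trans (+ₚ-comm p (map -_ p) i) (-ₚ-inverseˡ p i)
          ; ⁻¹-cong = λ {p} {q} → -ₚ-cong p q
          }
        ; comm = +ₚ-comm
        }
      ; *-cong     = λ {p} {q} {r} {s} → *ₚ-cong p q r s
      ; *-assoc    = *ₚ-assoc
      ; *-identity = *ₚ-identityˡ , *ₚ-identityʳ
      ; distrib    = *ₚ-distribˡ , *ₚ-distribʳ
      }
    }

  -- φ is the identity on K when multiplying in K[x], and extraction of a coefficient
  -- K[x] → K when multiplying in K[x][y].
  module _ {a ℓ′} (M : Monoid a ℓ′) {φ : Carrier → Monoid.Carrier M}
           (φ-homo : MonoidMorphisms.IsMonoidHomomorphism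
                       +-rawMonoid (Monoid.rawMonoid M) φ) where
    private
      module M = Monoid M
    open M using (_∙_; ε)
    open MonoidMorphisms.IsMonoidHomomorphism φ-homo

    φ-coeff-∷-* : ∀ a p q k → φ (coeff ((a ∷ p) *ₚ q) k) M.≈
                  φ (a * coeff q k) ∙ φ (coeff (0# ∷ p *ₚ q) k)
    φ-coeff-∷-* a p q k = M.trans (⟦⟧-cong (coeff-∷-* a p q k)) (homo _ _)

    -- No convolution sum is formed: the hypothesis on the terms travels down the recursion on `p`,
    -- and the target index `k` drops with each coefficient peeled off.
    coeff-*-zero : ∀ p q k →
      (∀ i j → i ℕ.+ j ≡ k → φ (coeff p i * coeff q j) M.≈ ε) →
      φ (coeff (p *ₚ q) k) M.≈ ε
    coeff-0∷-*-zero : ∀ p q k →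
      (∀ i j → suc i ℕ.+ j ≡ k → φ (coeff p i * coeff q j) M.≈ ε) →
      φ (coeff (0# ∷ p *ₚ q) k) M.≈ ε

    coeff-*-zero []      q k terms≈ε = ε-homo
    coeff-*-zero (a ∷ p) q k terms≈ε = M.trans (φ-coeff-∷-* a p q k)
      (M.trans (M.∙-cong (terms≈ε 0 k ≡.refl)
                         (coeff-0∷-*-zero p q k (terms≈ε ∘ suc)))
               (M.identityˡ ε))

    coeff-0∷-*-zero p q zero    terms≈ε = ε-homo
    coeff-0∷-*-zero p q (suc k) terms≈ε =
      coeff-*-zero p q k (λ i j i+j≡k → terms≈ε i j (≡.cong suc i+j≡k))

    -- Peeling coefficients off `p` leads to index `m`: the terms met before it vanish by
    -- hypothesis, and those after it form a shifted product, to which `coeff-0∷-*-zero` applies.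
    coeff-*-single : ∀ p q m n →
      (∀ i j → i ℕ.+ j ≡ m ℕ.+ n → i ≢ m → φ (coeff p i * coeff q j) M.≈ ε) →
      φ (coeff (p *ₚ q) (m ℕ.+ n)) M.≈ φ (coeff p m * coeff q n)
    coeff-*-single []      q m       n others≈ε = ⟦⟧-cong (sym (zeroˡ _))
    coeff-*-single (a ∷ p) q zero    n others≈ε = M.trans (φ-coeff-∷-* a p q n)
      (M.trans (M.∙-congˡ (coeff-0∷-*-zero p q n
                 (λ i j i+j≡n → others≈ε (suc i) j i+j≡n λ ())))
               (M.identityʳ _))
    coeff-*-single (a ∷ p) q (suc m) n others≈ε = M.trans (φ-coeff-∷-* a p q _)
      (M.trans (M.∙-cong (others≈ε 0 _ ≡.refl λ ())
                 (coeff-*-single p q m n (λ i j i+j≡m+n i≢m →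
                    others≈ε (suc i) j (≡.cong suc i+j≡m+n) (i≢m ∘ ≡.cong ℕ.pred))))
               (M.identityˡ _))

-- Factorizations controlled by an additive weight.

record IsAdditiveWeight {c ℓ w} (S : Semiring c ℓ)
                        (Weight : Semiring.Carrier S → ℕ → Set w) : Set (c ⊔ ℓ ⊔ w) where
  open Semiring S
  open RawSemiringDefinitions rawSemiring using (_∣_)
  field
    unique    : ∀ {x k l} → Weight x k → Weight x l → k ≡ l
    weight-1  : Weight 1# 0
    zero⇒unit : ∀ {x} → Weight x 0 → x ∣ 1#
    -- Weights pass from a product to its factors, so having one is demanded only of 1 and of
    -- divisors of elements that have one.
    split     : ∀ {x y z k} → Weight z k → z ≈ x * y →
                ∃[ l ] ∃[ m ] Weight x l × Weight y m × l ℕ.+ m ≡ k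

module AdditiveWeight
  {c ℓ w} (em : ExcludedMiddle (c ⊔ ℓ)) (S : Semiring c ℓ)
  (Weight : Semiring.Carrier S → ℕ → Set w)
  (isAdditiveWeight : IsAdditiveWeight S Weight)
  where

  open Semiring S hiding (zero)
  open RawSemiringDefinitions rawSemiring using (_∣_; _∤_)
  open IsAdditiveWeight isAdditiveWeight

  -- Were `x` a unit, splitting the weight 0 of 1 would give `x` weight 0 as well, against
  -- uniqueness.
  suc⇒nonunit : ∀ {x k} → Weight x (suc k) → x ∤ 1#
  suc⇒nonunit wx (q , qx≈1) with split weight-1 (sym qx≈1)
  ... | zero , zero , _ , wx′ , _ = contradiction (unique wx wx′) λ ()

  -- The weight 1 splits only as 0 + 1 or 1 + 0, and a factor of weight 0 is a unit.
  one⇒irreducible : ∀ {x} → Weight x 1 → Irreducible rawSemiring x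
  one⇒irreducible {x} wx = mkIrred (suc⇒nonunit wx) split-∣1
    where
    split-∣1 : ∀ {y z} → x ≈ y * z → y ∣ 1# ⊎ z ∣ 1#
    split-∣1 x≈yz with split wx x≈yz
    ... | zero     , _    , wy , _  , _ = inj₁ (zero⇒unit wy)
    ... | suc zero , zero , _  , wz , _ = inj₂ (zero⇒unit wz)

  -- Irreducibles are not units, so each takes at least 1 of the weight that the factors share.
  length≤weight : ∀ {x k} → Weight x k → ∀ ps →
                  IrreducibleFactorization rawSemiring x ps → length ps ≤ k
  length≤weight wx []       _ = z≤n
  length≤weight wx (p ∷ ps) (irr ∷ irrs , x≈p*ps) with split wx x≈p*ps
  ... | zero  , m , wp , _   , _      =
    contradiction (zero⇒unit wp) (Irreducible.p∤1 irr)
  ... | suc l , m , wp , wps , ≡.refl =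
    s≤s (ℕ.≤-trans (length≤weight wps ps (irrs , refl)) (ℕ.m≤n+m m l))

  product-++ : ∀ ps qs →
               foldr _*_ 1# (ps ++ qs) ≈ foldr _*_ 1# ps * foldr _*_ 1# qs
  product-++ []       qs = sym (*-identityˡ _)
  product-++ (p ∷ ps) qs = trans (*-congˡ (product-++ ps qs)) (sym (*-assoc p _ _))

  -- Well-founded induction on the weight: either `x` splits into two nonunits, both of smaller
  -- positive weight, or no such splitting exists and `x` is irreducible.
  factorization : ∀ {x k} → Weight x (suc k) → Acc _<_ (suc k) →
                  ∃[ ps ] IrreducibleFactorization rawSemiring x ps
  factorization {x} {k} wx (acc rec)
    with em {∃[ y ] ∃[ z ] x ≈ y * z × y ∤ 1# × z ∤ 1#}
  ... | no ¬split = x ∷ [] , irr ∷ [] , sym (*-identityʳ x)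
    where
    irr : Irreducible rawSemiring x
    irr = mkIrred (suc⇒nonunit wx) split-∣1
      where
      split-∣1 : ∀ {y z} → x ≈ y * z → y ∣ 1# ⊎ z ∣ 1#
      split-∣1 {y} {z} x≈yz with em {y ∣ 1#} | em {z ∣ 1#}
      ... | yes y∣1 | _       = inj₁ y∣1
      ... | no  _   | yes z∣1 = inj₂ z∣1
      ... | no  y∤1 | no  z∤1 = contradiction (y , z , x≈yz , y∤1 , z∤1) ¬split
  ... | yes (y , z , x≈yz , y∤1 , z∤1) with split wx x≈yz
  ...   | zero  , _     , wy , _  , _ = contradiction (zero⇒unit wy) y∤1
  ...   | suc l , zero  , _  , wz , _ = contradiction (zero⇒unit wz) z∤1
  ...   | suc l , suc m , wy , wz , ≡.refl =
    -- With `k` equal to `l + suc m`, both `suc l` and `suc m` are below `suc k`.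
    let ps , irr-ps , y≈ps = factorization wy (rec (s≤s (ℕ.m<m+n l z<s)))
        qs , irr-qs , z≈qs = factorization wz (rec (s≤s (ℕ.m≤n+m (suc m) l)))
    in ps ++ qs , ++⁺ irr-ps irr-qs ,
       trans x≈yz (trans (*-cong y≈ps z≈qs) (sym (product-++ ps qs)))

  -- Positive weight rules out units, for which a factorization without unit factor may fail to
  -- exist.
  productOfAtMost : ∀ {x k} → 0 < k → Weight x k → ProductOfAtMost rawSemiring k x
  productOfAtMost z<s wx = factorization wx (<-wellFounded _) , length≤weight wx

-- Monomial orders on exponents.

-- (i , k) stands for y^i x^k.
Exponent : Set
Exponent = ℕ × ℕ

infixl 6 _⊕_

_⊕_ : Exponent → Exponent → Exponent
(i , k) ⊕ (j , l) = i ℕ.+ j , k ℕ.+ l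

⊕-comm : ∀ u v → u ⊕ v ≡ v ⊕ u
⊕-comm (i , k) (j , l) = ≡.cong₂ _,_ (ℕ.+-comm i j) (ℕ.+-comm k l)

-- Weaker than the usual notion, which includes a well-order: under `_≺ˣ_` the powers of y descend
-- forever. Leading exponents exist because supports are finite.
record IsMonomialOrder (_≺_ : Rel Exponent 0ℓ) : Set where
  field
    compare : Trichotomous _≡_ _≺_
    ≺-trans : Transitive _≺_
    ⊕-monoˡ : ∀ w {u v} → u ≺ v → (u ⊕ w) ≺ (v ⊕ w)

  ≺-irrefl : ∀ {u} → ¬ (u ≺ u)
  ≺-irrefl = tri⇒irr compare ≡.refl

  ⊕-monoʳ : ∀ w {u v} → u ≺ v → (w ⊕ u) ≺ (w ⊕ v)
  ⊕-monoʳ w {u} {v} u≺v = ≡.subst₂ _≺_ (⊕-comm u w) (⊕-comm v w) (⊕-monoˡ w u≺v)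

  -- If neither `u′` lies above `u` nor `v′` above `v`, monotonicity leaves equality in both places
  -- or a strictly smaller sum. Taken at leading exponents `u` and `v`, the cases sort the terms of
  -- a product coefficient.
  ⊕-compare : ∀ u v u′ v′ → u ≺ u′ ⊎ v ≺ v′ ⊎ (u ≡ u′ × v ≡ v′) ⊎ (u′ ⊕ v′) ≺ (u ⊕ v)
  ⊕-compare u v u′ v′ with compare u u′ | compare v v′
  ... | tri< u≺u′ _ _ | _ = inj₁ u≺u′
  ... | tri≈ _ _ _    | tri< v≺v′ _ _ = inj₂ (inj₁ v≺v′)
  ... | tri> _ _ _    | tri< v≺v′ _ _ = inj₂ (inj₁ v≺v′)
  ... | tri≈ _ ≡.refl _ | tri≈ _ ≡.refl _ = inj₂ (inj₂ (inj₁ (≡.refl , ≡.refl)))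
  ... | tri≈ _ ≡.refl _ | tri> _ _ v′≺v = inj₂ (inj₂ (inj₂ (⊕-monoʳ u v′≺v)))
  ... | tri> _ _ u′≺u | tri≈ _ ≡.refl _ = inj₂ (inj₂ (inj₂ (⊕-monoˡ v u′≺u)))
  ... | tri> _ _ u′≺u | tri> _ _ v′≺v =
    inj₂ (inj₂ (inj₂ (≺-trans (⊕-monoˡ v′ u′≺u) (⊕-monoʳ u v′≺v))))

  maximum : ∀ {p} {P : Pred Exponent p} → Decidable P → ∀ L →
            All (∁ P) L ⊎ ∃[ u ] P u × All (λ w → u ≺ w → ¬ P w) L
  maximum P? []      = inj₁ []
  maximum P? (v ∷ L) with maximum P? L | P? v
  ... | inj₁ none           | no ¬Pv = inj₁ (¬Pv ∷ none)
  ... | inj₁ none           | yes Pv =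
    inj₂ (v , Pv , flip contradiction ≺-irrefl ∷ All.map const none)
  ... | inj₂ (u , Pu , max) | no ¬Pv = inj₂ (u , Pu , const ¬Pv ∷ max)
  ... | inj₂ (u , Pu , max) | yes Pv with compare u v
  ...   | tri< u≺v _ _ = inj₂ (v , Pv , flip contradiction ≺-irrefl ∷ All.map (_∘ ≺-trans u≺v) max)
  ...   | tri≈ u⊀v _ _ = inj₂ (u , Pu , flip contradiction u⊀v ∷ max)
  ...   | tri> u⊀v _ _ = inj₂ (u , Pu , flip contradiction u⊀v ∷ max)

_≺ʸ_ : Rel Exponent 0ℓ
_≺ʸ_ = ×-Lex _≡_ _<_ _<_

-- Since ties go to the lower power of y, a leading exponent (s , D) forces every coefficient of y^i
-- with i < s to have x-degree strictly below D.
_≺ˣ_ : Rel Exponent 0ℓ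
_≺ˣ_ = ×-Lex _≡_ _<_ _>_ on swap

lex-compare : ∀ {_<₁_ _<₂_ : Rel ℕ 0ℓ} →
              Trichotomous _≡_ _<₁_ → Trichotomous _≡_ _<₂_ →
              Trichotomous _≡_ (×-Lex _≡_ _<₁_ _<₂_)
lex-compare cmp₁ cmp₂ u v with ×-compare ≡.sym cmp₁ cmp₂ u v
... | tri< u<v u≉v u≯v = tri< u<v (u≉v ∘ ≡⇒≡×≡) u≯v
... | tri≈ u≮v u≈v u≯v = tri≈ u≮v (≡×≡⇒≡ u≈v) u≯v
... | tri> u≮v u≉v u>v = tri> u≮v (u≉v ∘ ≡⇒≡×≡) u>v

≺ʸ-isMonomialOrder : IsMonomialOrder _≺ʸ_
≺ʸ-isMonomialOrder = record
  { compare = lex-compare ℕ.<-cmp ℕ.<-cmp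
  ; ≺-trans = λ {u} {v} {w} → ×-transitive {_<₂_ = _<_}
      ≡.isEquivalence (≡.resp₂ _<_) ℕ.<-trans ℕ.<-trans {u} {v} {w}
  ; ⊕-monoˡ = λ where
      (i , k) (inj₁ i<j)            → inj₁ (ℕ.+-monoˡ-< i i<j)
      (i , k) (inj₂ (≡.refl , k<l)) → inj₂ (≡.refl , ℕ.+-monoˡ-< k k<l)
  }

≺ˣ-isMonomialOrder : IsMonomialOrder _≺ˣ_
≺ˣ-isMonomialOrder = record
  { compare = compareˣ
  ; ≺-trans = λ {u} {v} {w} → ×-transitive {_<₂_ = _>_}
      ≡.isEquivalence (≡.resp₂ _<_) ℕ.<-trans (flip ℕ.<-trans) {swap u} {swap v} {swap w}
  ; ⊕-monoˡ = λ where
      (i , k) (inj₁ k<l)            → inj₁ (ℕ.+-monoˡ-< k k<l)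
      (i , k) (inj₂ (≡.refl , i>j)) → inj₂ (≡.refl , ℕ.+-monoˡ-< i i>j)
  }
  where
  compareˣ : Trichotomous _≡_ _≺ˣ_
  compareˣ u v with lex-compare ℕ.<-cmp (Flip.compare _ ℕ.<-cmp) (swap u) (swap v)
  ... | tri< u<v u≢v u≯v = tri< u<v (u≢v ∘ ≡.cong swap) u≯v
  ... | tri≈ u≮v u≡v u≯v = tri≈ u≮v (≡.cong swap u≡v) u≯v
  ... | tri> u≮v u≢v u>v = tri> u≮v (u≢v ∘ ≡.cong swap) u>v

-- Degrees read off from coefficients.

module Degree {c ℓ} (R : Ring c ℓ) (_≟0 : Decidable (λ x → Ring._≈_ R x (Ring.0# R))) where
  open Ring R hiding (zero)
  open Polynomials R

  HasDegree : List Carrier → ℕ ₋ → Set ℓ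
  HasDegree p ⊥₋    = p ≈ₚ []
  HasDegree p [ d ] = coeff p d ≉ 0# × (∀ {i} → d < i → coeff p i ≈ 0#)

  hasDegree-deg : ∀ p → HasDegree p (deg _≟0 p)
  hasDegree-deg []      = λ i → refl
  hasDegree-deg (a ∷ p) with deg _≟0 p | hasDegree-deg p | a ≟0
  ... | [ d ] | top≉0 , above≈0 | _       = top≉0 , λ { (s≤s d<i) → above≈0 d<i }
  ... | ⊥₋    | p≈0             | yes a≈0 = λ { zero → a≈0 ; (suc i) → p≈0 i }
  ... | ⊥₋    | p≈0             | no  a≉0 = a≉0 , λ { (s≤s _) → p≈0 _ }

  -- A degree with another one strictly below it is not -∞.
  deg<deg⇒finite : ∀ p q → deg _≟0 p <₋ deg _≟0 q → ∃[ d ] deg _≟0 q ≡ [ d ]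
  deg<deg⇒finite p q p<q with deg _≟0 p | deg _≟0 q | p<q
  ... | ⊥₋    | [ d ] | _ = d , ≡.refl
  ... | [ _ ] | [ d ] | _ = d , ≡.refl

  deg<⇒coeff≈0 : ∀ p {d} → deg _≟0 p <₋ [ d ] → ∀ {i} → d ≤ i → coeff p i ≈ 0#
  deg<⇒coeff≈0 p {d} deg<d {i} d≤i with deg _≟0 p | hasDegree-deg p
  deg<⇒coeff≈0 p ⊥₋<[ d ] {i} d≤i | ⊥₋    | p≈0         = p≈0 i
  deg<⇒coeff≈0 p [ e<d ]      d≤i | [ e ] | _ , above≈0 = above≈0 (ℕ.<-≤-trans e<d d≤i)

-- Coefficients of bivariate products.

module Bivariate {c ℓ} (em : ExcludedMiddle (c ⊔ ℓ)) (𝕂 : Field c ℓ) where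
  open Field 𝕂 hiding (zero)
  module X = Polynomials ring
  module XY = Polynomials X.polynomialRing
  module K[x] = Ring X.polynomialRing
  module K[x,y] = Ring XY.polynomialRing

  *-≉0 : ∀ {a b} → a ≉ 0# → b ≉ 0# → a * b ≉ 0#
  *-≉0 {a} {b} a≉0 b≉0 ab≈0 with ≉0⇒invertible a≉0
  ... | a⁻¹ , a⁻¹a≈1 , _ = b≉0 (begin
    b                ≈⟨ *-identityˡ b ⟨
    1# * b           ≈⟨ *-congʳ a⁻¹a≈1 ⟨
    a⁻¹ * a * b      ≈⟨ *-assoc _ a b ⟩
    a⁻¹ * (a * b)    ≈⟨ *-congˡ ab≈0 ⟩
    a⁻¹ * 0#         ≈⟨ zeroʳ _ ⟩
    0#               ∎)
    where open SetoidReasoning setoid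

  infix 8 _⟨_⟩

  _⟨_⟩ : K[x,y].Carrier → Exponent → Carrier
  f ⟨ i , k ⟩ = X.coeff (XY.coeff f i) k

  private
    id-homo = isMonoidHomomorphism (Monoid.rawMonoid +-monoid) refl

    coeff-homo : ∀ k → MonoidMorphisms.IsMonoidHomomorphism
                         K[x].+-rawMonoid +-rawMonoid (λ p → X.coeff p k)
    coeff-homo k = record
      { isMagmaHomomorphism = record
        { isRelHomomorphism = record { cong = λ p≈q → p≈q k }
        ; homo              = λ p q → X.coeff-+ p q k
        }
      ; ε-homo = refl
      }

  -- `coeff-*-zero` is used twice: in y, with extraction of the x^k coefficient as the homomorphism,
  -- then in x, with the identity.
  ⟨⟩-*-zero : ∀ f g w → (∀ u v → u ⊕ v ≡ w → f ⟨ u ⟩ * g ⟨ v ⟩ ≈ 0#) →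
              (f K[x,y].* g) ⟨ w ⟩ ≈ 0#
  ⟨⟩-*-zero f g (i , k) terms≈0 =
    XY.coeff-*-zero +-monoid (coeff-homo k) f g i λ i₁ i₂ i≡ →
    X.coeff-*-zero +-monoid id-homo (XY.coeff f i₁) (XY.coeff g i₂) k λ k₁ k₂ k≡ →
    terms≈0 (i₁ , k₁) (i₂ , k₂) (≡.cong₂ _,_ i≡ k≡)

  ⟨⟩-*-single : ∀ f g u v →
    (∀ u′ v′ → u′ ⊕ v′ ≡ u ⊕ v → u′ ≢ u → f ⟨ u′ ⟩ * g ⟨ v′ ⟩ ≈ 0#) →
    (f K[x,y].* g) ⟨ u ⊕ v ⟩ ≈ f ⟨ u ⟩ * g ⟨ v ⟩
  ⟨⟩-*-single f g (i , k) (j , l) others≈0 = trans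
    (XY.coeff-*-single +-monoid (coeff-homo (k ℕ.+ l)) f g i j λ i₁ i₂ i≡ i₁≢i →
      X.coeff-*-zero +-monoid id-homo (XY.coeff f i₁) (XY.coeff g i₂) (k ℕ.+ l) λ k₁ k₂ k≡ →
      others≈0 (i₁ , k₁) (i₂ , k₂) (≡.cong₂ _,_ i≡ k≡) (i₁≢i ∘ ≡.cong proj₁))
    -- The y-exponents now agree, so the other terms differ in the x-exponent.
    (X.coeff-*-single +-monoid id-homo (XY.coeff f i) (XY.coeff g j) k l λ k₁ k₂ k≡ k₁≢k →
      others≈0 (i , k₁) (j , k₂) (≡.cong₂ _,_ ≡.refl k≡) (k₁≢k ∘ ≡.cong proj₂))

  -- The sum of the lengths of all coefficient lists bounds each of them at once.
  x-bound : ∀ f → ∃[ N ] (∀ {i k} → N ≤ k → f ⟨ i , k ⟩ ≈ 0#)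
  x-bound []      = 0 , λ _ → refl
  x-bound (p ∷ f) = length p ℕ.+ N , λ {i} → bound i
    where
    N = proj₁ (x-bound f)
    bound : ∀ i {k} → length p ℕ.+ N ≤ k → (p ∷ f) ⟨ i , k ⟩ ≈ 0#
    bound zero    N≤k = reflexive (X.coeff-≥length p (ℕ.m+n≤o⇒m≤o _ N≤k))
    bound (suc i) N≤k = proj₂ (x-bound f) {i} (ℕ.m+n≤o⇒n≤o (length p) N≤k)

  -- A finite box around the true support; exponents in it with zero coefficient are filtered out by
  -- `maximum`.
  support : K[x,y].Carrier → List Exponent
  support f = cartesianProduct (upTo (length f)) (upTo (proj₁ (x-bound f)))

  ∈-support : ∀ f {u} → f ⟨ u ⟩ ≉ 0# → u ∈ support f
  ∈-support f {i , k} fu≉0 = ∈-cartesianProduct⁺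
    (∈-upTo⁺ (ℕ.≰⇒> λ len≤i → fu≉0 (
      reflexive (≡.cong (λ p → X.coeff p k) (XY.coeff-≥length f len≤i)))))
    (∈-upTo⁺ (ℕ.≰⇒> λ N≤k → fu≉0 (proj₂ (x-bound f) {i} N≤k)))

  -- Leading exponents and their additivity.

  module Leading {_≺_ : Rel Exponent 0ℓ} (≺-isMonomialOrder : IsMonomialOrder _≺_) where
    open IsMonomialOrder ≺-isMonomialOrder

    IsLeading : K[x,y].Carrier → Exponent → Set ℓ
    IsLeading f u = f ⟨ u ⟩ ≉ 0# × (∀ {v} → u ≺ v → f ⟨ v ⟩ ≈ 0#)

    leading-unique : ∀ f {u v} → IsLeading f u → IsLeading f v → u ≡ v
    leading-unique f {u} {v} (fu≉0 , fu≈0) (fv≉0 , fv≈0) with compare u v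
    ... | tri< u≺v _ _ = contradiction (fu≈0 u≺v) fv≉0
    ... | tri≈ _ u≡v _ = u≡v
    ... | tri> _ _ v≺u = contradiction (fv≈0 v≺u) fu≉0

    leading-cong : ∀ f g {u} → f K[x,y].≈ g → IsLeading f u → IsLeading g u
    leading-cong f g {i , k} f≈g (fu≉0 , f≈0) =
      (λ gu≈0 → fu≉0 (trans (f≈g i k) gu≈0)) ,
      λ {v} u≺v → trans (sym (f≈g (proj₁ v) (proj₂ v))) (f≈0 u≺v)

    leading? : ∀ f → (∃[ u ] IsLeading f u) ⊎ (∀ u → f ⟨ u ⟩ ≈ 0#)
    leading? f with maximum (λ u → ¬? (≈0? em rawRing (f ⟨ u ⟩))) (support f)
    ... | inj₁ none           = inj₂ λ u →
      decidable-stable (≈0? em rawRing (f ⟨ u ⟩)) λ fu≉0 → All.lookup none (∈-support f fu≉0) fu≉0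
    ... | inj₂ (u , fu≉0 , max) = inj₁ (u , fu≉0 , λ {v} u≺v →
      decidable-stable (≈0? em rawRing (f ⟨ v ⟩)) λ fv≉0 → All.lookup max (∈-support f fv≉0) u≺v fv≉0)

    -- At `u ⊕ v` only the product of the two leading coefficients survives, and a field has no zero
    -- divisors. At a larger exponent every term has a factor beyond its leading exponent.
    leading-* : ∀ f g {u v} → IsLeading f u → IsLeading g v →
                IsLeading (f K[x,y].* g) (u ⊕ v)
    leading-* f g {u} {v} (fu≉0 , f≈0) (gv≉0 , g≈0) = top , above
      where
      fʳ : ∀ {u′} v′ → u ≺ u′ → f ⟨ u′ ⟩ * g ⟨ v′ ⟩ ≈ 0#
      fʳ v′ u≺u′ = trans (*-congʳ (f≈0 u≺u′)) (zeroˡ _)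
      gˡ : ∀ u′ {v′} → v ≺ v′ → f ⟨ u′ ⟩ * g ⟨ v′ ⟩ ≈ 0#
      gˡ u′ v≺v′ = trans (*-congˡ (g≈0 v≺v′)) (zeroʳ _)

      top : (f K[x,y].* g) ⟨ u ⊕ v ⟩ ≉ 0#
      top fg≈0 = *-≉0 fu≉0 gv≉0 (trans (sym (⟨⟩-*-single f g u v others)) fg≈0)
        where
        others : ∀ u′ v′ → u′ ⊕ v′ ≡ u ⊕ v → u′ ≢ u → f ⟨ u′ ⟩ * g ⟨ v′ ⟩ ≈ 0#
        others u′ v′ eq u′≢u with ⊕-compare u v u′ v′
        ... | inj₁ u≺u′                         = fʳ v′ u≺u′
        ... | inj₂ (inj₁ v≺v′)                  = gˡ u′ v≺v′
        ... | inj₂ (inj₂ (inj₁ (≡.refl , _)))   = contradiction ≡.refl u′≢u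
        ... | inj₂ (inj₂ (inj₂ u′⊕v′≺u⊕v)) =
          contradiction (≡.subst (_≺ (u ⊕ v)) eq u′⊕v′≺u⊕v) ≺-irrefl

      above : ∀ {w} → (u ⊕ v) ≺ w → (f K[x,y].* g) ⟨ w ⟩ ≈ 0#
      above {w} u⊕v≺w = ⟨⟩-*-zero f g w terms
        where
        terms : ∀ u′ v′ → u′ ⊕ v′ ≡ w → f ⟨ u′ ⟩ * g ⟨ v′ ⟩ ≈ 0#
        terms u′ v′ ≡.refl with ⊕-compare u v u′ v′
        ... | inj₁ u≺u′                            = fʳ v′ u≺u′
        ... | inj₂ (inj₁ v≺v′)                     = gˡ u′ v≺v′
        ... | inj₂ (inj₂ (inj₁ (≡.refl , ≡.refl))) = contradiction u⊕v≺w ≺-irrefl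
        ... | inj₂ (inj₂ (inj₂ u′⊕v′≺u⊕v))         =
          contradiction (≺-trans u⊕v≺w u′⊕v′≺u⊕v) ≺-irrefl

    -- A factor without leading exponent is zero and would annihilate the nonzero coefficient of `f`
    -- at `w`. Otherwise `leading-*` and uniqueness apply.
    leading-factors : ∀ f g h {w} → f K[x,y].≈ g K[x,y].* h → IsLeading f w →
      ∃[ u ] ∃[ v ] IsLeading g u × IsLeading h v × u ⊕ v ≡ w
    leading-factors f g h {w} f≈gh f-lead@(fw≉0 , _) with leading? g | leading? h
    ... | inj₂ g≈0 | _ = contradiction
      (trans (f≈gh _ _) (⟨⟩-*-zero g h w λ u v _ → trans (*-congʳ (g≈0 u)) (zeroˡ _))) fw≉0
    ... | _ | inj₂ h≈0 = contradiction
      (trans (f≈gh _ _) (⟨⟩-*-zero g h w λ u v _ → trans (*-congˡ (h≈0 v)) (zeroʳ _))) fw≉0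
    ... | inj₁ (u , g-lead) | inj₁ (v , h-lead) = u , v , g-lead , h-lead ,
      leading-unique f
        (leading-cong (g K[x,y].* h) f (K[x,y].sym {f} {g K[x,y].* h} f≈gh)
          (leading-* g h g-lead h-lead))
        f-lead

  -- The weight of a bivariate polynomial.

  module Leadingʸ = Leading ≺ʸ-isMonomialOrder
  module Leadingˣ = Leading ≺ˣ-isMonomialOrder

  -- Only polynomials with constant leading coefficient in y and nonzero coefficient at y^0 get a
  -- weight; both properties pass to factors. The difference m - s is expressed by a sum to avoid
  -- truncated subtraction.
  record Weight (f : K[x,y].Carrier) (k : ℕ) : Set ℓ where
    constructor weight
    field
      {m s D}  : ℕ
      leadingʸ : Leadingʸ.IsLeading f (m , 0)
      leadingˣ : Leadingˣ.IsLeading f (s , D)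
      y∤       : ¬ (∀ i → f ⟨ 0 , i ⟩ ≈ 0#)
      m≡s+k    : m ≡ s ℕ.+ k

  weight-unique : ∀ {f k l} → Weight f k → Weight f l → k ≡ l
  weight-unique {f} (weight {s = s} ly lx _ m≡s+k) (weight ly′ lx′ _ m≡s+l)
    with ≡.refl ← Leadingʸ.leading-unique f ly ly′
       | ≡.refl ← Leadingˣ.leading-unique f lx lx′ =
    ℕ.+-cancelˡ-≡ s _ _ (≡.trans (≡.sym m≡s+k) m≡s+l)

  weight-1 : Weight K[x,y].1# 0
  weight-1 = weight {m = 0} {s = 0} {D = 0}
    (1≉0 , λ {u} u≻0 → 1⟨⟩≈0 u (λ u≡0 → ≺ʸ.≺-irrefl (≡.subst (_ ≺ʸ_) u≡0 u≻0)))
    (1≉0 , λ {u} u≻0 → 1⟨⟩≈0 u (λ u≡0 → ≺ˣ.≺-irrefl (≡.subst (_ ≺ˣ_) u≡0 u≻0)))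
    (λ 1≈0 → 1≉0 (1≈0 0)) ≡.refl
    where
    module ≺ʸ = IsMonomialOrder ≺ʸ-isMonomialOrder
    module ≺ˣ = IsMonomialOrder ≺ˣ-isMonomialOrder
    1⟨⟩≈0 : ∀ u → u ≢ (0 , 0) → K[x,y].1# ⟨ u ⟩ ≈ 0#
    1⟨⟩≈0 (zero  , zero)  u≢0 = contradiction ≡.refl u≢0
    1⟨⟩≈0 (zero  , suc _) _   = refl
    1⟨⟩≈0 (suc _ , _)     _   = refl

  open RawSemiringDefinitions (Semiring.rawSemiring K[x,y].semiring) using (_∣_)

  weight-0⇒unit : ∀ {f} → Weight f 0 → f ∣ K[x,y].1#
  weight-0⇒unit {f} (weight {m} {s} {D} (fm0≉0 , f≈0ʸ) (fsD≉0 , f≈0ˣ) y∤ m≡s+0)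
    with ≡.refl ← ≡.trans m≡s+0 (ℕ.+-identityʳ s) | D
  -- As s = m, a positive D would put y^m x^D above the leading y^m.
  ... | suc _ = contradiction (f≈0ʸ (inj₂ (≡.refl , z<s))) fsD≉0
  ... | zero with m
  -- Now y^m leads for `_≺ˣ_` too; for m > 0 every x^i lies above it, so y would divide `f`.
  ...   | suc _ = contradiction below y∤
    where
    below : ∀ i → f ⟨ 0 , i ⟩ ≈ 0#
    below zero    = f≈0ˣ (inj₂ (≡.refl , z<s))
    below (suc i) = f≈0ˣ (inj₁ z<s)
  -- What remains is a nonzero constant, and `q` is its inverse.
  ...   | zero with ≉0⇒invertible fm0≉0
  ...     | α⁻¹ , α⁻¹α≈1 , _ = q , λ i k → trans
    (K[x,y].*-cong {q} {q} {f} {(f ⟨ 0 , 0 ⟩ ∷ []) ∷ []} (λ _ _ → refl) f≈α i k) (qα≈1 i k)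
    where
    q = (α⁻¹ ∷ []) ∷ []
    f≈α : f K[x,y].≈ (f ⟨ 0 , 0 ⟩ ∷ []) ∷ []
    f≈α zero    zero    = refl
    f≈α zero    (suc k) = f≈0ʸ (inj₂ (≡.refl , z<s))
    f≈α (suc i) k       = f≈0ʸ (inj₁ z<s)
    qα≈1 : q K[x,y].* ((f ⟨ 0 , 0 ⟩ ∷ []) ∷ []) K[x,y].≈ K[x,y].1#
    qα≈1 zero    zero    = trans (+-identityʳ _) α⁻¹α≈1
    qα≈1 zero    (suc k) = refl
    qα≈1 (suc i) k       = refl

  -- Two y-exponents with sum 0 are both 0, so if the coefficient of y^0 vanishes in a factor, it
  -- vanishes in the product.
  y∤-factors : ∀ f g h → f K[x,y].≈ g K[x,y].* h → ¬ (∀ i → f ⟨ 0 , i ⟩ ≈ 0#) →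
               ¬ (∀ i → g ⟨ 0 , i ⟩ ≈ 0#) × ¬ (∀ i → h ⟨ 0 , i ⟩ ≈ 0#)
  y∤-factors f g h f≈gh y∤f =
    (λ g≈0 → y∤f λ k → trans (f≈gh 0 k) (⟨⟩-*-zero g h (0 , k) λ where
      (zero , i) v eq → trans (*-congʳ (g≈0 i)) (zeroˡ _))) ,
    (λ h≈0 → y∤f λ k → trans (f≈gh 0 k) (⟨⟩-*-zero g h (0 , k) λ where
      (zero , _) (zero , i) eq → trans (*-congˡ (h≈0 i)) (zeroʳ _)))

  -- The monomial y^s x^D occurs in `f`, whose y-degree is m.
  s≤m : ∀ f {m e s D} → Leadingʸ.IsLeading f (m , e) → Leadingˣ.IsLeading f (s , D) → s ≤ m
  s≤m f (_ , f≈0) (fsD≉0 , _) = ℕ.≮⇒≥ λ m<s → fsD≉0 (f≈0 (inj₁ m<s))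

  weight-split : ∀ {g h f k} → Weight f k → f K[x,y].≈ g K[x,y].* h →
                 ∃[ l ] ∃[ l′ ] Weight g l × Weight h l′ × l ℕ.+ l′ ≡ k
  weight-split {g} {h} {f} {k} (weight ly lx y∤f m≡s+k) f≈gh
    with (m₁ , e₁) , (m₂ , e₂) , gy , hy , ≡m ← Leadingʸ.leading-factors f g h f≈gh ly
       | (s₁ , D₁) , (s₂ , D₂) , gx , hx , ≡.refl ← Leadingˣ.leading-factors f g h f≈gh lx
    -- The x-parts for `_≺ʸ_` add up to 0: both factors have a constant leading coefficient in y.
    with ≡.refl ← ℕ.m+n≡0⇒m≡0 e₁ (≡.cong proj₂ ≡m)
       | ≡.refl ← ℕ.m+n≡0⇒n≡0 e₁ (≡.cong proj₂ ≡m)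
       | l  , ≡.refl ← ℕ.m≤n⇒∃[o]m+o≡n (s≤m g gy gx)
       | l′ , ≡.refl ← ℕ.m≤n⇒∃[o]m+o≡n (s≤m h hy hx)
       | y∤g , y∤h ← y∤-factors f g h f≈gh y∤f =
    l , l′ , weight gy gx y∤g ≡.refl , weight hy hx y∤h ≡.refl ,
    -- Cancels s₁ + s₂ from (s₁ + s₂) + (l + l′) = m₁ + m₂ = (s₁ + s₂) + k.
    ℕ.+-cancelˡ-≡ (s₁ ℕ.+ s₂) _ _
      (≡.trans (interchange s₁ s₂ l l′) (≡.trans (≡.cong proj₁ ≡m) m≡s+k))
    where open CommutativeSemigroupProperties ℕ.+-commutativeSemigroup using (interchange)

  isAdditiveWeight : IsAdditiveWeight K[x,y].semiring Weight
  isAdditiveWeight = record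
    { unique    = weight-unique
    ; weight-1  = weight-1
    ; zero⇒unit = weight-0⇒unit
    ; split     = λ {g} {h} {f} → weight-split {g} {h} {f}
    }

  open AdditiveWeight em K[x,y].semiring Weight isAdditiveWeight public
    using (one⇒irreducible; productOfAtMost)

  -- The weight of the polynomial with the given coefficients.

  private
    _≟0 = ≈0? em rawRing
    deg = X.deg _≟0
  open Degree ring _≟0

  -- The leading exponents are (n , 0), because a_n is a nonzero constant, and (j , D) with D = deg
  -- a_j, because a_j dominates all other coefficients.
  weight-tabulate : ∀ n (a : Fin (suc n) → K[x].Carrier) →
    ∃[ α ] a (fromℕ n) K[x].≈ X.constant α →
    a zero K[x].* a (fromℕ n) K[x].≉ K[x].0# →
    (j : Fin n) →
    (∀ i → i ≢ inject₁ j → deg (a i) <₋ deg (a (inject₁ j))) →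
    Weight (tabulate a) (n ∸ toℕ j)
  weight-tabulate n a (α , aₙ≈α) a₀aₙ≉0 j deg<degⱼ =
    weight leadingʸ leadingˣ y∤
      (≡.sym (ℕ.m+[n∸m]≡n (ℕ.<⇒≤ (Fin.toℕ<n j))))
    where
    f = tabulate a

    f⟨⟩≈ : ∀ {i} i′ → toℕ i′ ≡ i → ∀ k → f ⟨ i , k ⟩ ≈ X.coeff (a i′) k
    f⟨⟩≈ i′ ≡.refl k = reflexive (≡.cong (λ p → X.coeff p k) (XY.coeff-tabulate a i′))

    -- Powers of y above n lie beyond the list and have coefficient 0, so only genuine indices need
    -- checking.
    f⟨⟩≈0 : ∀ {i k} → (∀ i′ → toℕ i′ ≡ i → X.coeff (a i′) k ≈ 0#) → f ⟨ i , k ⟩ ≈ 0#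
    f⟨⟩≈0 {i} {k} aᵢ≈0 with i ℕ.<? suc n
    ... | yes i≤n = trans (f⟨⟩≈ (fromℕ< i≤n) (Fin.toℕ-fromℕ< i≤n) k)
                          (aᵢ≈0 (fromℕ< i≤n) (Fin.toℕ-fromℕ< i≤n))
    ... | no  i≰n = reflexive (≡.cong (λ p → X.coeff p k) (XY.coeff-≥length f
      (≡.subst (_≤ i) (≡.sym (length-tabulate a)) (ℕ.≮⇒≥ i≰n))))

    α≉0 : α ≉ 0#
    α≉0 α≈0 = a₀aₙ≉0 (K[x].trans {a zero K[x].* a (fromℕ n)} {a zero K[x].* []} {[]}
      (K[x].*-congˡ {a zero} {a (fromℕ n)} {[]} aₙ≈0) (K[x].zeroʳ (a zero)))
      where
      aₙ≈0 : a (fromℕ n) K[x].≈ []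
      aₙ≈0 zero    = trans (aₙ≈α 0) α≈0
      aₙ≈0 (suc k) = aₙ≈α (suc k)

    leadingʸ : Leadingʸ.IsLeading f (n , 0)
    leadingʸ = (λ fₙ≈0 → α≉0 (trans (sym (trans (fₙ≈aₙ 0) (aₙ≈α 0))) fₙ≈0)) , above
      where
      fₙ≈aₙ = f⟨⟩≈ (fromℕ n) (Fin.toℕ-fromℕ n)
      above : ∀ {u} → (n , 0) ≺ʸ u → f ⟨ u ⟩ ≈ 0#
      above (inj₁ n<i) = f⟨⟩≈0 λ i′ i′≡i →
        contradiction (≡.subst (n <_) (≡.sym i′≡i) n<i) (ℕ.≤⇒≯ (Fin.toℕ≤pred[n] i′))
      above {_ , suc k} (inj₂ (≡.refl , _)) = trans (fₙ≈aₙ (suc k)) (aₙ≈α (suc k))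

    y∤ : ¬ (∀ i → f ⟨ 0 , i ⟩ ≈ 0#)
    y∤ a₀≈0 = a₀aₙ≉0 (K[x].trans {a zero K[x].* a (fromℕ n)} {[] K[x].* a (fromℕ n)} {[]}
      (K[x].*-congʳ {a (fromℕ n)} {a zero} {[]} a₀≈0) (K[x].zeroˡ (a (fromℕ n))))

    aⱼ = a (inject₁ j)

    finite : ∃[ D ] deg aⱼ ≡ [ D ]
    -- The index n differs from j, so a_n supplies a degree below that of a_j.
    finite = deg<deg⇒finite (a (fromℕ n)) aⱼ (deg<degⱼ (fromℕ n) Fin.fromℕ≢inject₁)

    D = proj₁ finite

    aⱼ-hasDegree : HasDegree aⱼ [ D ]
    aⱼ-hasDegree = ≡.subst (HasDegree aⱼ) (proj₂ finite) (hasDegree-deg aⱼ)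

    aᵢ≈0 : ∀ i → i ≢ inject₁ j → ∀ {k} → D ≤ k → X.coeff (a i) k ≈ 0#
    aᵢ≈0 i i≢j = deg<⇒coeff≈0 (a i) (≡.subst (deg (a i) <₋_) (proj₂ finite) (deg<degⱼ i i≢j))

    above-D≈0 : ∀ i {k} → D < k → X.coeff (a i) k ≈ 0#
    above-D≈0 i D<k with i Fin.≟ inject₁ j
    -- Above D, a_j vanishes by definition of the degree; the other coefficients vanish from D on.
    ... | yes ≡.refl = proj₂ aⱼ-hasDegree D<k
    ... | no  i≢j    = aᵢ≈0 i i≢j (ℕ.<⇒≤ D<k)

    leadingˣ : Leadingˣ.IsLeading f (toℕ j , D)
    leadingˣ = (λ fⱼ≈0 → proj₁ aⱼ-hasDegree (trans (sym fⱼ≈aⱼ) fⱼ≈0)) , λ {u} → above {u}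
      where
      fⱼ≈aⱼ = f⟨⟩≈ (inject₁ j) (Fin.toℕ-inject₁ j) D
      above : ∀ {u} → (toℕ j , D) ≺ˣ u → f ⟨ u ⟩ ≈ 0#
      above {i , _} (inj₁ D<k) = f⟨⟩≈0 {i} λ i′ _ → above-D≈0 i′ D<k
      -- A tie at x^D: the index is below j, and a coefficient other than a_j has no x^D term.
      above {i , _} (inj₂ (≡.refl , i<j)) = f⟨⟩≈0 {i} λ i′ i′≡i → aᵢ≈0 i′
        (λ i′≡j → ℕ.<⇒≢ i<j (≡.trans (≡.sym i′≡i) (≡.trans (≡.cong toℕ i′≡j) (Fin.toℕ-inject₁ j))))
        ℕ.≤-refl

theorem5 :
  ∀ {c ℓ} (em : ExcludedMiddle (c ⊔ ℓ)) (𝕂 : Field c ℓ) →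
  let K      = Field.rawRing 𝕂
      K[x]   = K [X]
      K[x,y] = RawRing.rawSemiring (K[x] [X])
      deg    = Polynomial.deg K (≈0? em K)
      open RawRing K[x]
  in
  (n : ℕ) → 2 ≤ n →
  (a : Fin (suc n) → Carrier) →
  (∃[ α ] a (fromℕ n) ≈ Polynomial.constant K α) →
  a zero * a (fromℕ n) ≉ 0# →
  (j : Fin n) →
  (∀ i → i ≢ inject₁ j → deg (a i) <₋ deg (a (inject₁ j))) →
  let f = tabulate a in
  ProductOfAtMost K[x,y] (n ∸ toℕ j) f ×
  (toℕ j ≡ n ∸ 1 → Irreducible K[x,y] f)
theorem5 em 𝕂 n 2≤n a aₙ-constant a₀aₙ≉0 j deg<degⱼ =
  productOfAtMost (ℕ.m<n⇒0<n∸m (Fin.toℕ<n j)) f-weight ,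
  λ j≡n∸1 → one⇒irreducible (≡.subst (Weight (tabulate a)) (n∸j≡1 j≡n∸1) f-weight)
  where
  open Bivariate em 𝕂
  f-weight = weight-tabulate n a aₙ-constant a₀aₙ≉0 j deg<degⱼ
  n∸j≡1 : toℕ j ≡ n ∸ 1 → n ∸ toℕ j ≡ 1
  -- The truncated subtractions cancel because `2≤n` gives 1 ≤ n.
  n∸j≡1 j≡n∸1 = ≡.trans (≡.cong (n ∸_) j≡n∸1) (ℕ.m∸[m∸n]≡n (ℕ.<⇒≤ 2≤n))
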